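{- Let $n \in \mathbb{N}$, $k \in \mathbb{N}\setminus\{0\}$ and let $$\delta = \begin{cases} 1 & \text{if } n = 0,\\ k & \text{if } n \neq 0 \text{ and } k \leq n,\\ k-1 & \text{if } n \neq 0 \text{ and } k > n.\end{cases}$$ Then $\{(2^k+1)\cdot 2^{n+i} - (2^k-1) : i \in \{0,1,\dots,n+\delta\}\}$ is a minimal system of generators of $GT(n,k)$.
   Context: $\mathbb{N}$ is the set of nonnegative integers. For a nonempty $A\subseteq\mathbb{N}$, $\langle A\rangle$ denotes the submonoid of $(\mathbb{N},+)$ generated by $A$. $GT(n,k) = \langle \{(2^k+1)\cdot 2^{n+i} - (2^k-1) : i \in \mathbb{N}\}\rangle$ (the generalized Thabit numerical semigroup). A set $A$ is a system of generators of $S$ if $S=\langle A\rangle$; it is a minimal system of generators of $S$ if moreover $S\neq\langle X\rangle$ for every proper subset $X\subsetneq A$. -}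

module Defs where

open import Data.Bool using (if_then_else_)
open import Data.Nat using (ℕ; zero; suc; _+_; _*_; _∸_; _^_; _≤?_)
open import Data.Product using (_×_; ∃-syntax)
open import Level using (Level; 0ℓ)
open import Relation.Binary.PropositionalEquality using (_≡_)
open import Relation.Nullary using (¬_; does)
open import Relation.Unary using (Pred; _∈_; _⊂_; _≐_)

private
  variable
    ℓ : Level

-- Also defined for empty A, where it is {0}.
data ⟨_⟩ (A : Pred ℕ ℓ) : Pred ℕ ℓ where
  generator : ∀ {x} → x ∈ A → x ∈ ⟨ A ⟩
  identity  : 0 ∈ ⟨ A ⟩
  sum       : ∀ {x y} → x ∈ ⟨ A ⟩ → y ∈ ⟨ A ⟩ → (x + y) ∈ ⟨ A ⟩

IsSystemOfGenerators : Pred ℕ 0ℓ → Pred ℕ 0ℓ → Set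
IsSystemOfGenerators S A = S ≐ ⟨ A ⟩

IsMinimalSystemOfGenerators : Pred ℕ 0ℓ → Pred ℕ 0ℓ → Set₁
IsMinimalSystemOfGenerators S A =
  IsSystemOfGenerators S A ×
  (∀ (X : Pred ℕ 0ℓ) → X ⊂ A → ¬ (S ≐ ⟨ X ⟩))

-- Neither subtraction truncates: 1 ≤ 2 ^ k and 2 ^ k ∸ 1 ≤ (2 ^ k + 1) * 2 ^ (n + i).
element : ℕ → ℕ → ℕ → ℕ
element n k i = (2 ^ k + 1) * 2 ^ (n + i) ∸ (2 ^ k ∸ 1)

GT : ℕ → ℕ → Pred ℕ 0ℓ
GT n k = ⟨ (λ x → ∃[ i ] x ≡ element n k i) ⟩

δ : ℕ → ℕ → ℕ
δ zero      k = 1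
δ n@(suc _) k = if does (k ≤? n) then k else k ∸ 1

{-# OPTIONS --safe #-}
-- With c = 2^k - 1 and A = (2^k + 1) 2^n, the generators s i satisfy s i + c = A 2^i, so a sum
-- of t generators has the form A P - t c, where P is the sum of the corresponding t powers of 2.
-- If it equals s m with t ≥ 2, then A divides t - 1 because A is coprime to c; writing
-- t - 1 = u A gives P = 2^m + u c, and t ≤ P becomes 1 + u (s 0) ≤ 2^m.  Conversely, if
-- s 0 < 2^m, then 2^m + c is a sum of c + 2 powers of 2 below 2^m, and halving parts
-- turns it into a sum of exactly 1 + A powers, which exhibits s m as a sum of 1 + A
-- earlier generators.  Hence s m is redundant exactly when s 0 < 2^m, and n + δ is the
-- integer part of the binary logarithm of s 0.
module Submission where

open import Defs
open import Data.Bool using (if_then_else_)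
open import Data.Nat using (ℕ; zero; suc; _+_; _*_; _∸_; _^_; _≤_; _<_; _≤?_; _≟_; z≤n; s≤s;
                            NonZero; >-nonZero; ≢-nonZero)
open import Data.Nat.Coprimality using (Coprime; coprime-divisor; coprime-+; 1-coprimeTo)
open import Data.Nat.Divisibility using (_∣_; divides; ∣-trans; m∣m*n; ∣1⇒≡1; ∣m+n∣m⇒∣n)
open import Data.Nat.Induction using (<-rec)
open import Data.Nat.Properties
open import Data.Nat.Tactic.RingSolver using (solve-∀)
open import Data.Product using (_×_; _,_; ∃-syntax; proj₁; proj₂)
open import Data.Sum using (inj₁; inj₂)
open import Level using (Level)
open import Relation.Binary.PropositionalEquality
open import Relation.Nullary using (yes; no; contradiction)
open import Relation.Nullary.Decidable using (dec-true; dec-false)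
open import Relation.Unary using (Pred; _∈_; _⊆_)

private
  variable
    a b : Level

-- Generated submonoids and irreducible elements

⟨⟩-bind : {X : Pred ℕ a} {Y : Pred ℕ b} → X ⊆ ⟨ Y ⟩ → ⟨ X ⟩ ⊆ ⟨ Y ⟩
⟨⟩-bind f (generator x∈X) = f x∈X
⟨⟩-bind f identity        = identity
⟨⟩-bind f (sum p q)       = sum (⟨⟩-bind f p) (⟨⟩-bind f q)

⟨⟩-mono : {X : Pred ℕ a} {Y : Pred ℕ b} → X ⊆ Y → ⟨ X ⟩ ⊆ ⟨ Y ⟩
⟨⟩-mono X⊆Y = ⟨⟩-bind (λ p → generator (X⊆Y p))

Irreducible : Pred ℕ a → Pred ℕ a
Irreducible S x = x ≢ 0 × (∀ {y z} → y ∈ S → z ∈ S → y ≢ 0 → z ≢ 0 → y + z ≢ x)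

-- Descend through the derivation: in a sum, irreducibility forces one summand to be 0, so the other
-- summand is the element itself.
irreducible⇒generator : {X : Pred ℕ a} {x : ℕ} → Irreducible ⟨ X ⟩ x → x ∈ ⟨ X ⟩ → x ∈ X
irreducible⇒generator irr (generator x∈X) = x∈X
irreducible⇒generator irr identity = contradiction refl (proj₁ irr)
irreducible⇒generator {X = X} irr (sum {y} {z} p q) with y ≟ 0 | z ≟ 0
... | yes refl | _        = irreducible⇒generator irr q
... | no _     | yes refl =
  subst (_∈ X) (sym (+-identityʳ y))
    (irreducible⇒generator (subst (Irreducible ⟨ X ⟩) (+-identityʳ y) irr) p)
... | no y≢0   | no z≢0   = contradiction refl (proj₂ irr p q y≢0 z≢0)

-- Irreducible elements belong to every generating set, so a generating `X` cannot omit any element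
-- of `A`.
irreducible-generators⇒minimal : {S A : Pred ℕ _} → IsSystemOfGenerators S A →
  (∀ {x} → x ∈ A → Irreducible S x) → IsMinimalSystemOfGenerators S A
irreducible-generators⇒minimal gen irr = gen , λ X (_ , A⊈X) (S⊆⟨X⟩ , ⟨X⟩⊆S) →
  A⊈X λ x∈A → irreducible⇒generator
    (proj₁ (irr x∈A) , λ p q → proj₂ (irr x∈A) (⟨X⟩⊆S p) (⟨X⟩⊆S q))
    (S⊆⟨X⟩ (proj₂ gen (generator x∈A)))

-- Sums of a prescribed number of powers of 2

data PowerSum (m : ℕ) : ℕ → ℕ → Set where
  []  : PowerSum m 0 0
  _∷_ : ∀ {i t P} → i < m → PowerSum m t P → PowerSum m (suc t) (2 ^ i + P)

-- Some part exceeds 1, as otherwise t = P. Parts equal to 1 are passed over, and the first larger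
-- one is replaced by its two halves.
split : ∀ {m t P} → PowerSum m t P → t < P → PowerSum m (suc t) P
split (_∷_ {zero} i<m ps) (s≤s t<P) = i<m ∷ split ps t<P
split {m} (_∷_ {suc i} {t} {P} i<m ps) _ =
  subst (PowerSum m (suc (suc t))) (halve (2 ^ i) P) (i<m′ ∷ (i<m′ ∷ ps))
  where
  i<m′ : i < m
  i<m′ = ≤-trans (n≤1+n (suc i)) i<m
  halve : ∀ p q → p + (p + q) ≡ 2 * p + q
  halve = solve-∀

split-to : ∀ {m t P} d → PowerSum m t P → d + t ≤ P → PowerSum m (d + t) P
split-to zero    ps _    = ps
split-to (suc d) ps d+t<P = split (split-to d ps (<⇒≤ d+t<P)) d+t<P

ones : ∀ {m} → 0 < m → ∀ c → PowerSum m c c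
ones 0<m zero    = []
ones 0<m (suc c) = 0<m ∷ ones 0<m c

-- Semigroups generated by a shifted geometric sequence

module ShiftedGeometric
  (A c : ℕ) (s : ℕ → ℕ) (s+c≡A*2^ : ∀ i → s i + c ≡ A * 2 ^ i)
  (A-coprime-c : Coprime A c) (c+2≤A : c + 2 ≤ A)
  where

  Values : Pred ℕ _
  Values x = ∃[ i ] x ≡ s i

  ValuesBelow : ℕ → Pred ℕ _
  ValuesBelow m x = ∃[ i ] (i < m × x ≡ s i)

  s₀+c≡A : s 0 + c ≡ A
  s₀+c≡A = trans (s+c≡A*2^ 0) (*-identityʳ A)

  instance
    A≢0 : NonZero A
    A≢0 = >-nonZero (≤-trans (s≤s z≤n) (≤-trans (m≤n+m 2 c) c+2≤A))

  s≢0 : ∀ i → s i ≢ 0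
  s≢0 i sᵢ≡0 = contradiction (begin-strict
    c                <⟨ m<m+n c (s≤s z≤n) ⟩
    c + 2            ≤⟨ c+2≤A ⟩
    A                ≤⟨ m≤m*n A (2 ^ i) {{m^n≢0 2 i}} ⟩
    A * 2 ^ i        ≡⟨ s+c≡A*2^ i ⟨
    s i + c          ≡⟨ cong (_+ c) sᵢ≡0 ⟩
    c                ∎) (<-irrefl refl)
    where open ≤-Reasoning

  add-forms : ∀ {P Q} x y t u → x + t * c ≡ A * P → y + u * c ≡ A * Q →
              (x + y) + (t + u) * c ≡ A * (P + Q)
  add-forms {P} {Q} x y t u p q = begin
    (x + y) + (t + u) * c       ≡⟨ rearrange x y t u c ⟩
    (x + t * c) + (y + u * c)   ≡⟨ cong₂ _+_ p q ⟩
    A * P + A * Q               ≡⟨ *-distribˡ-+ A P Q ⟨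
    A * (P + Q)                 ∎
    where
    open ≡-Reasoning
    rearrange : ∀ x y t u c → (x + y) + (t + u) * c ≡ (x + t * c) + (y + u * c)
    rearrange = solve-∀

  s-form : ∀ i → s i + 1 * c ≡ A * 2 ^ i
  s-form i = trans (cong (s i +_) (*-identityˡ c)) (s+c≡A*2^ i)

  realise : ∀ {m t P} → PowerSum m t P →
            ∃[ x ] (x ∈ ⟨ ValuesBelow m ⟩ × x + t * c ≡ A * P)
  realise [] = 0 , identity , sym (*-zeroʳ A)
  realise (_∷_ {i} {t} i<m ps) with x , x∈ , eq ← realise ps =
    s i + x , sum (generator (i , i<m , refl)) x∈ , add-forms (s i) x 1 t (s-form i) eq

  reduce : ∀ m → 0 < m → s 0 < 2 ^ m → s m ∈ ⟨ ValuesBelow m ⟩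
  reduce m@(suc l) 0<m s₀<2^m with m≤n⇒∃[o]m+o≡n c+2≤A
  -- The starting sum is 2^l + 2^l followed by c ones, which has c + 2 parts; `suc d` halvings bring
  -- the count to 1 + A. There is room for them because s 0 < 2^m becomes 1 + A ≤ P after adding c.
  ... | d , c+2+d≡A with realise (split-to (suc d) (≤-refl ∷ (≤-refl ∷ ones 0<m c)) t≤P)
    where
    P : ℕ
    P = 2 ^ l + (2 ^ l + c)
    double : ∀ p c → p + (p + c) ≡ 2 * p + c
    double = solve-∀
    open ≤-Reasoning
    t≤P : suc d + (2 + c) ≤ P
    t≤P = begin
      suc (d + (2 + c))       ≡⟨ cong suc (+-comm d (2 + c)) ⟩
      suc ((2 + c) + d)       ≡⟨ cong (λ e → suc (e + d)) (+-comm 2 c) ⟩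
      suc (c + 2 + d)         ≡⟨ cong suc c+2+d≡A ⟩
      suc A                   ≡⟨ cong suc s₀+c≡A ⟨
      suc (s 0) + c           ≤⟨ +-monoˡ-≤ c s₀<2^m ⟩
      2 ^ m + c               ≡⟨ double (2 ^ l) c ⟨
      P                       ∎
  ... | x , x∈ , eq = subst (_∈ ⟨ ValuesBelow m ⟩) x≡sₘ x∈
    where
    open ≡-Reasoning
    count : ∀ d c → suc d + (2 + c) ≡ 1 + (c + 2 + d)
    count = solve-∀
    expand : ∀ A p c → A * (p + (p + c)) ≡ A * (2 * p) + A * c
    expand = solve-∀
    collect : ∀ x c A → (x + c) + A * c ≡ x + (1 + A) * c
    collect = solve-∀
    x≡sₘ : x ≡ s m
    x≡sₘ = +-cancelʳ-≡ c x (s m) (+-cancelʳ-≡ (A * c) (x + c) (s m + c) (begin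
      (x + c) + A * c              ≡⟨ collect x c A ⟩
      x + (1 + A) * c              ≡⟨ cong (λ e → x + (1 + e) * c) c+2+d≡A ⟨
      x + (1 + (c + 2 + d)) * c    ≡⟨ cong (λ e → x + e * c) (count d c) ⟨
      x + (suc d + (2 + c)) * c    ≡⟨ eq ⟩
      A * (2 ^ l + (2 ^ l + c))    ≡⟨ expand A (2 ^ l) c ⟩
      A * 2 ^ m + A * c            ≡⟨ cong (_+ A * c) (s+c≡A*2^ m) ⟨
      (s m + c) + A * c            ∎))

  -- What irreducibility needs from a sum of t generators: of P being a sum of t powers of 2 only
  -- `t ≤ P` is kept, and the last component makes a nonzero x use at least one generator.
  Form : Pred ℕ _
  Form x = ∃[ t ] ∃[ P ] (t ≤ P × x + t * c ≡ A * P × (t ≡ 0 → x ≡ 0))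

  form : ⟨ Values ⟩ ⊆ Form
  form (generator (i , refl)) = 1 , 2 ^ i , m^n>0 2 i , s-form i , λ ()
  form identity               = 0 , 0 , z≤n , sym (*-zeroʳ A) , λ _ → refl
  form (sum {x} {y} p q) with t , P , t≤P , eq , z ← form p | u , Q , u≤Q , eq′ , z′ ← form q =
    t + u , P + Q , +-mono-≤ t≤P u≤Q , add-forms x y t u eq eq′ ,
    λ t+u≡0 → cong₂ _+_ (z (m+n≡0⇒m≡0 t t+u≡0)) (z′ (m+n≡0⇒n≡0 t t+u≡0))

  -- Replacing s m + c by A 2^m leaves A dividing c v, hence v by coprimality; then A cancels.
  excess : ∀ {m v P} → s m + (1 + v) * c ≡ A * P →
           ∃[ u ] (v ≡ u * A × P ≡ 2 ^ m + u * c)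
  excess {m} {v} {P} eq with coprime-divisor A-coprime-c A∣c*v
    where
    rearrange : ∀ x c v → (x + c) + c * v ≡ x + (1 + v) * c
    rearrange = solve-∀
    open ≡-Reasoning
    split-off : A * 2 ^ m + c * v ≡ P * A
    split-off = begin
      A * 2 ^ m + c * v    ≡⟨ cong (_+ c * v) (s+c≡A*2^ m) ⟨
      (s m + c) + c * v    ≡⟨ rearrange (s m) c v ⟩
      s m + (1 + v) * c    ≡⟨ eq ⟩
      A * P                ≡⟨ *-comm A P ⟩
      P * A                ∎
    A∣c*v : A ∣ c * v
    A∣c*v = ∣m+n∣m⇒∣n (divides P split-off) (m∣m*n (2 ^ m))
  ... | divides u refl = u , refl , *-cancelˡ-≡ P (2 ^ m + u * c) A (begin
      A * P                       ≡⟨ eq ⟨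
      s m + (1 + u * A) * c       ≡⟨ rearrange (s m) c u A ⟩
      (s m + c) + A * (u * c)     ≡⟨ cong (_+ A * (u * c)) (s+c≡A*2^ m) ⟩
      A * 2 ^ m + A * (u * c)     ≡⟨ *-distribˡ-+ A (2 ^ m) (u * c) ⟨
      A * (2 ^ m + u * c)         ∎)
    where
    rearrange : ∀ x c u A → x + (1 + u * A) * c ≡ (x + c) + A * (u * c)
    rearrange = solve-∀
    open ≡-Reasoning

  no-excess : ∀ {m v P} .{{_ : NonZero v}} → 2 ^ m ≤ s 0 → 1 + v ≤ P →
              s m + (1 + v) * c ≢ A * P
  no-excess {m} {v} 2^m≤s₀ v<P eq with excess {m} {v} eq
  -- u = 0 would make v = 0, against its `NonZero` instance.
  no-excess {m} {{()}} 2^m≤s₀ v<P eq | zero , refl , refl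
  no-excess {m} 2^m≤s₀ v<P eq | u@(suc _) , refl , refl = <⇒≱ s₀<2^m 2^m≤s₀
    where
    open ≤-Reasoning
    expand : ∀ u s c → 1 + u * (s + c) ≡ (1 + u * s) + u * c
    expand = solve-∀
    s₀<2^m : s 0 < 2 ^ m
    -- Since A = s 0 + c, the terms u c cancel from 1 + u A ≤ 2^m + u c, and u ≥ 1 gives the bound.
    s₀<2^m = ≤-trans (s≤s (m≤n*m (s 0) u)) (+-cancelʳ-≤ (u * c) _ _ (begin
      (1 + u * s 0) + u * c   ≡⟨ expand u (s 0) c ⟨
      1 + u * (s 0 + c)       ≡⟨ cong (λ e → 1 + u * e) s₀+c≡A ⟩
      1 + u * A               ≤⟨ v<P ⟩
      2 ^ m + u * c           ∎))

  irreducible : ∀ m → 2 ^ m ≤ s 0 → Irreducible ⟨ Values ⟩ (s m)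
  irreducible m 2^m≤s₀ = s≢0 m , λ p q → indecomposable (form p) (form q)
    where
    indecomposable : ∀ {y z} → y ∈ Form → z ∈ Form → y ≢ 0 → z ≢ 0 → y + z ≢ s m
    indecomposable (zero , _ , _ , _ , y≡0) _ y≢0 _ _ = y≢0 (y≡0 refl)
    indecomposable _ (zero , _ , _ , _ , z≡0) _ z≢0 _ = z≢0 (z≡0 refl)
    indecomposable {y} {z} (suc t , P , t≤P , eq , _) (suc u , Q , u≤Q , eq′ , _) _ _ y+z≡sₘ =
      -- Each nonzero summand uses a generator, so the total count is 1 + v with v = t + suc u
      -- positive.
      no-excess {m} {t + suc u} {P + Q} {{≢-nonZero (m+1+n≢0 t)}} 2^m≤s₀ (+-mono-≤ t≤P u≤Q)
        (trans (cong (_+ (suc t + suc u) * c) (sym y+z≡sₘ)) (add-forms y z (suc t) (suc u) eq eq′))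

  -- The lower bound makes every s i with i ≤ D irreducible; the upper bound lets strong induction
  -- rewrite every later generator through earlier ones.
  minimalGenerators : ∀ D → 2 ^ D ≤ s 0 → s 0 < 2 ^ suc D →
    IsMinimalSystemOfGenerators ⟨ Values ⟩ (λ x → ∃[ i ] (i ≤ D × x ≡ s i))
  minimalGenerators D lower upper = irreducible-generators⇒minimal
    ( ⟨⟩-bind (λ { (i , refl) → generated i })
    , ⟨⟩-mono (λ (i , _ , x≡sᵢ) → i , x≡sᵢ) )
    λ { (i , i≤D , refl) → irreducible i (≤-trans (^-monoʳ-≤ 2 i≤D) lower) }
    where
    Initial : Pred ℕ _
    Initial x = ∃[ i ] (i ≤ D × x ≡ s i)
    step : ∀ m → (∀ {i} → i < m → s i ∈ ⟨ Initial ⟩) → s m ∈ ⟨ Initial ⟩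
    step m rec with ≤-<-connex m D
    ... | inj₁ m≤D = generator (m , m≤D , refl)
    ... | inj₂ D<m = ⟨⟩-bind (λ { (i , i<m , refl) → rec i<m })
      (reduce m (≤-trans (s≤s z≤n) D<m) (<-≤-trans upper (^-monoʳ-≤ 2 D<m)))
    generated : ∀ m → s m ∈ ⟨ Initial ⟩
    generated = <-rec (λ m → s m ∈ ⟨ Initial ⟩) step

-- The Thabit generators as a shifted geometric sequence

coprime-* : ∀ {m n o} → Coprime m o → Coprime n o → Coprime (m * n) o
coprime-* cm cn (d∣mn , d∣o) =
  -- As d divides o, it is coprime to m, so it divides n.
  cn (coprime-divisor (λ (e∣d , e∣m) → cm (e∣m , ∣-trans e∣d d∣o)) d∣mn , d∣o)

coprime-^ : ∀ {m o} → Coprime m o → ∀ n → Coprime (m ^ n) o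
coprime-^ {o = o} cm zero    = 1-coprimeTo o
coprime-^         cm (suc n) = coprime-* cm (coprime-^ cm n)

1+[2^k∸1]≡2^k : ∀ k → 1 + (2 ^ k ∸ 1) ≡ 2 ^ k
1+[2^k∸1]≡2^k k = m+[n∸m]≡n (m^n>0 2 k)

2^k+1≡[2^k∸1]+2 : ∀ k → 2 ^ k + 1 ≡ (2 ^ k ∸ 1) + 2
2^k+1≡[2^k∸1]+2 k = trans (cong (_+ 1) (sym (1+[2^k∸1]≡2^k k))) (shift (2 ^ k ∸ 1))
  where
  shift : ∀ c → (1 + c) + 1 ≡ c + 2
  shift = solve-∀

coprime-2-2^k∸1 : ∀ k .{{_ : NonZero k}} → Coprime 2 (2 ^ k ∸ 1)
coprime-2-2^k∸1 k@(suc l) {d} (d∣2 , d∣c) = ∣1⇒≡1 (∣m+n∣m⇒∣n d∣c+1 d∣c)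
  where
  d∣c+1 : d ∣ (2 ^ k ∸ 1) + 1
  d∣c+1 = subst (d ∣_) (sym (trans (+-comm _ 1) (1+[2^k∸1]≡2^k k))) (∣-trans d∣2 (m∣m*n (2 ^ l)))

-- With c = 2^k - 1 the first factor is c + 2, so both factors reduce to c being odd, which holds as
-- k > 0.
ratio-coprime : ∀ n k .{{_ : NonZero k}} → Coprime ((2 ^ k + 1) * 2 ^ n) (2 ^ k ∸ 1)
ratio-coprime n k = coprime-*
  (subst (λ m → Coprime m (2 ^ k ∸ 1)) (sym (2^k+1≡[2^k∸1]+2 k)) (coprime-+ (coprime-2-2^k∸1 k)))
  (coprime-^ (coprime-2-2^k∸1 k) n)

c+2≤ratio : ∀ n k → (2 ^ k ∸ 1) + 2 ≤ (2 ^ k + 1) * 2 ^ n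
c+2≤ratio n k = ≤-trans (≤-reflexive (sym (2^k+1≡[2^k∸1]+2 k))) (m≤m*n (2 ^ k + 1) (2 ^ n) {{m^n≢0 2 n}})

element+c : ∀ n k i → element n k i + (2 ^ k ∸ 1) ≡ (2 ^ k + 1) * 2 ^ n * 2 ^ i
element+c n k i = begin
  element n k i + (2 ^ k ∸ 1)      ≡⟨ m∸n+n≡m (≤-trans (m≤m+n _ 2) (c+2≤ratio (n + i) k)) ⟩
  (2 ^ k + 1) * 2 ^ (n + i)        ≡⟨ cong ((2 ^ k + 1) *_) (^-distribˡ-+-* 2 n i) ⟩
  (2 ^ k + 1) * (2 ^ n * 2 ^ i)    ≡⟨ *-assoc (2 ^ k + 1) (2 ^ n) (2 ^ i) ⟨
  (2 ^ k + 1) * 2 ^ n * 2 ^ i      ∎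
  where open ≡-Reasoning

-- The binary logarithm of the first Thabit generator

element₀+2^k : ∀ n k → element n k 0 + 2 ^ k ≡ 2 ^ n * 2 ^ k + (2 ^ n + 1)
element₀+2^k n k = begin
  element n k 0 + 2 ^ k                    ≡⟨ cong (element n k 0 +_) (1+[2^k∸1]≡2^k k) ⟨
  element n k 0 + (1 + (2 ^ k ∸ 1))        ≡⟨ +-suc (element n k 0) (2 ^ k ∸ 1) ⟩
  1 + (element n k 0 + (2 ^ k ∸ 1))        ≡⟨ cong suc (element+c n k 0) ⟩
  1 + (2 ^ k + 1) * 2 ^ n * 1              ≡⟨ expand (2 ^ k) (2 ^ n) ⟩
  2 ^ n * 2 ^ k + (2 ^ n + 1)              ∎
  where
  open ≡-Reasoning
  expand : ∀ q p → 1 + (q + 1) * p * 1 ≡ p * q + (p + 1)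
  expand = solve-∀

δ-≤ : ∀ {n k} .{{_ : NonZero n}} → k ≤ n → δ n k ≡ k
δ-≤ {n@(suc _)} {k} k≤n = cong (if_then k else k ∸ 1) (dec-true (k ≤? n) k≤n)

δ-> : ∀ {n k} .{{_ : NonZero n}} → n < k → δ n k ≡ k ∸ 1
δ-> {n@(suc _)} {k} n<k = cong (if_then k else k ∸ 1) (dec-false (k ≤? n) (<⇒≱ n<k))

-- Both bounds are read off after adding 2^k, which removes the subtraction in element.
log₂-element₀ : ∀ n k .{{_ : NonZero k}} →
  2 ^ (n + δ n k) ≤ element n k 0 × element n k 0 < 2 ^ suc (n + δ n k)
-- For n = 0 the first generator is 2 whatever k is, and the bounds read 2 ≤ 2 < 4.
log₂-element₀ zero k = ≤-reflexive (sym e≡2) , ≤-trans (≤-reflexive (cong suc e≡2)) (n≤1+n 3)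
  where
  rearrange : ∀ q → 1 * q + 2 ≡ 2 + q
  rearrange = solve-∀
  e≡2 : element 0 k 0 ≡ 2
  e≡2 = +-cancelʳ-≡ (2 ^ k) _ 2 (trans (element₀+2^k 0 k) (rearrange (2 ^ k)))
log₂-element₀ n@(suc _) k@(suc l) with ≤-<-connex k n
... | inj₁ k≤n rewrite δ-≤ k≤n =
  +-cancelʳ-≤ q _ _ (begin
    2 ^ (n + k) + q       ≡⟨ cong (_+ q) (^-distribˡ-+-* 2 n k) ⟩
    p * q + q             ≤⟨ +-monoʳ-≤ (p * q) (≤-trans (^-monoʳ-≤ 2 k≤n) (m≤m+n p 1)) ⟩
    p * q + (p + 1)       ≡⟨ element₀+2^k n k ⟨
    element n k 0 + q     ∎) ,
  +-cancelʳ-< q _ _ (begin-strict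
    element n k 0 + q     ≡⟨ element₀+2^k n k ⟩
    p * q + (p + 1)       <⟨ +-monoʳ-< (p * q) (+-mono-≤-< (m≤m*n p q {{m^n≢0 2 k}}) 1<q) ⟩
    p * q + (p * q + q)   ≡⟨ double (p * q) q ⟩
    2 * (p * q) + q       ≡⟨ cong (λ e → 2 * e + q) (^-distribˡ-+-* 2 n k) ⟨
    2 ^ suc (n + k) + q   ∎)
  where
  open ≤-Reasoning
  p = 2 ^ n
  q = 2 ^ k
  1<q : 1 < q
  1<q = ^-monoʳ-< 2 ≤-refl {0} {k} (s≤s z≤n)
  double : ∀ a q → a + (a + q) ≡ 2 * a + q
  double = solve-∀
-- Here q = 2 r. The lower bound rests on 2 ≤ p, from n > 0, and the upper one on p + 1 < 2 p ≤ q,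
-- from n < k.
... | inj₂ n<k rewrite δ-> n<k =
  +-cancelʳ-≤ q _ _ (begin
    2 ^ (n + l) + q         ≡⟨ cong (_+ q) (^-distribˡ-+-* 2 n l) ⟩
    p * r + 2 * r           ≤⟨ +-monoʳ-≤ (p * r) (*-monoˡ-≤ r 2≤p) ⟩
    p * r + p * r           ≡⟨ double p r ⟩
    p * q                   ≤⟨ m≤m+n (p * q) (p + 1) ⟩
    p * q + (p + 1)         ≡⟨ element₀+2^k n k ⟨
    element n k 0 + q       ∎) ,
  +-cancelʳ-< q _ _ (begin-strict
    element n k 0 + q       ≡⟨ element₀+2^k n k ⟩
    p * q + (p + 1)         <⟨ +-monoʳ-< (p * q) p+1<q ⟩
    p * q + q               ≡⟨ cong (_+ q) (halve p r) ⟩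
    2 * (p * r) + q         ≡⟨ cong (λ e → 2 * e + q) (^-distribˡ-+-* 2 n l) ⟨
    2 ^ suc (n + l) + q     ∎)
  where
  open ≤-Reasoning
  p = 2 ^ n
  q = 2 ^ k
  r = 2 ^ l
  2≤p : 2 ≤ p
  2≤p = ^-monoʳ-< 2 ≤-refl {0} {n} (s≤s z≤n)
  double : ∀ p r → p * r + p * r ≡ p * (2 * r)
  double = solve-∀
  halve : ∀ p r → p * (2 * r) ≡ 2 * (p * r)
  halve = solve-∀
  twice : ∀ p → p + p ≡ 2 * p
  twice = solve-∀
  p+1<q : p + 1 < q
  p+1<q = begin-strict
    p + 1   <⟨ +-monoʳ-< p 2≤p ⟩
    p + p   ≡⟨ twice p ⟩
    2 * p   ≤⟨ ^-monoʳ-≤ 2 n<k ⟩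
    q       ∎

theorem3p6 : (n k : ℕ) .{{_ : NonZero k}} →
    IsMinimalSystemOfGenerators (GT n k)
    (λ x → ∃[ i ] (i ≤ n + δ n k × x ≡ element n k i))
theorem3p6 n k = minimalGenerators (n + δ n k) (proj₁ bounds) (proj₂ bounds)
  where
  open ShiftedGeometric ((2 ^ k + 1) * 2 ^ n) (2 ^ k ∸ 1) (element n k)
    (element+c n k) (ratio-coprime n k) (c+2≤ratio n k)
  bounds = log₂-element₀ n k
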